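{- Let $p,p'$ be two POPs of size $k$ having the same set of isolated vertices $I=\{i_1<i_2<\dots<i_s\}$ (with $s\ge 1$). Suppose that for every $x\in [i_1,k]\setminus I$ and every $y\in[i_1-1]$ we have $y<_p x$ and $y<_{p'}x$. Let $I_p,I_{p'}$ be the subposets of $p,p'$ induced by the labels $[i_1-1]$, and let $J_p,J_{p'}$ be the subposets of $p,p'$ induced by the labels $[i_1,k]\setminus I$. If $I_p\sim_s I_{p'}$ and $J_p=J_{p'}$ (as labeled posets), then $p\sim p'$.
   Context: A partially ordered pattern (POP) $p$ of size $k$ is a partial order $\le_p$ on the label set $[k]=\{1,\dots,k\}$. A permutation $\pi=\pi_1\cdots\pi_n\in\mathfrak S_n$ contains $p$ if there are indices $i_1<\dots<i_k$ such that $\pi_{i_j}<\pi_{i_m}$ whenever $j<_p m$; otherwise $\pi$ avoids $p$. $\mathfrak S_n(p)$ denotes the set of permutations in $\mathfrak S_n$ avoiding $p$. Two POPs $p,q$ are Wilf-equivalent, $p\sim q$, if $|\mathfrak S_n(p)|=|\mathfrak S_n(q)|$ for all $n\ge1$. A vertex (label) of $p$ is isolated if it is comparable to no other vertex. For $[a,b]=\{a,a+1,\dots,b\}$. A subposet induced by a set of labels keeps the order restricted to those labels (when the labels are $[r]$ it is a POP of size $r$). A Ferrers board $\lambda=(\lambda_1\ge\lambda_2\ge\dots\ge\lambda_n>0)$ with $\lambda_1=n$ is drawn in French notation: rows are numbered $1,\dots,n$ from bottom to top, columns from left to right, and row $i$ consists of the cells $(i,1),\dots,(i,\lambda_i)$.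 A transversal of $\lambda$ is a $0/1$-filling of its cells with exactly one $1$ in each row and each column. A transversal $T$ contains a POP $p$ of size $m$ if there are rows $r_1<\dots<r_m$ and columns $c_1<\dots<c_m$ such that every cell $(r_a,c_b)$ lies in $\lambda$, and for each $b$ the $1$ of column $c_b$ lies in row $r_{\sigma(b)}$ for some $\sigma(b)\in[m]$ (so $\sigma$ is a permutation), with $\sigma(j)<\sigma(m')$ whenever $j<_p m'$; otherwise $T$ avoids $p$. Two POPs $p,q$ are shape-Wilf-equivalent, $p\sim_s q$, if for every Ferrers board $\lambda$ the number of transversals of $\lambda$ avoiding $p$ equals the number avoiding $q$. -}

module Defs where

open import Data.Fin.Base using (Fin; toℕ; inject; finToFun; funToFin; _≤_; _<_)
open import Data.Fin.Patterns using (1F)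
open import Data.Fin.Properties using (_≟_; _<?_; any?; all?; toℕ-injective; toℕ-inject; finToFun-funToFin)
open import Data.List.Base using (List; allFin; filter; length; map)
open import Data.Nat.Base as ℕ using (ℕ; _^_)
import Data.Nat.Properties as ℕ
open import Data.Product.Base using (∃; ∃-syntax; _×_; _,_)
open import Data.Product using (∃!)
open import Data.Sum.Base using (_⊎_)
open import Function.Base using (_on_; _∘_)
open import Function.Bundles using (_⇔_)
open import Function.Consequences.Propositional using (strictlySurjective⇒surjective; surjective⇒strictlySurjective)
open import Function.Definitions using (Injective; Bijective)
open import Level using (0ℓ)
open import Relation.Binary.Core using (Rel; _Preserves_⟶_)
import Relation.Binary.Construct.NonStrictToStrict as ToStrict
open import Relation.Binary.PropositionalEquality using (_≡_; _≢_; _≗_; refl; sym; trans; cong; subst₂; isEquivalence)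
open import Relation.Binary.Structures using (IsDecPartialOrder)
open import Relation.Nullary.Decidable using (Dec; map′; ¬?; _×-dec_; _→-dec_)
open import Relation.Nullary.Negation using (¬_)
open import Relation.Unary using (Pred; Decidable)

------------------------------------------------------------------------
-- Partially ordered patterns

-- Everything is indexed from 0: label, position, value, row or column
-- i + 1 of [k] is the element i of Fin k.

record POP (k : ℕ) : Set₁ where
  field
    _≤ₚ_              : Rel (Fin k) 0ℓ
    isDecPartialOrder : IsDecPartialOrder _≡_ _≤ₚ_

  open IsDecPartialOrder isDecPartialOrder public
    using (reflexive; antisym; trans) renaming (_≤?_ to _≤ₚ?_)

  open ToStrict _≡_ _≤ₚ_ public using () renaming (_<_ to _<ₚ_)

  _<ₚ?_ : ∀ i j → Dec (i <ₚ j)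
  _<ₚ?_ = ToStrict.<-decidable _≡_ _≤ₚ_ _≟_ _≤ₚ?_

  Isolated : Pred (Fin k) 0ℓ
  Isolated i = ∀ j → j ≢ i → ¬ (i ≤ₚ j ⊎ j ≤ₚ i)

order : ∀ {k} → POP k → Rel (Fin k) 0ℓ
order p = POP._≤ₚ_ p

strictOrder : ∀ {k} → POP k → Rel (Fin k) 0ℓ
strictOrder p = POP._<ₚ_ p

syntax order p i j = i ≤[ p ] j
syntax strictOrder p i j = i <[ p ] j

induced : ∀ {r k} (f : Fin r → Fin k) → Injective _≡_ _≡_ f → POP k → POP r
induced f f-inj p = record
  { _≤ₚ_ = P._≤ₚ_ on f
  ; isDecPartialOrder = record
    { isPartialOrder = record
      { isPreorder = record
        { isEquivalence = isEquivalence
        ; reflexive     = P.reflexive ∘ cong f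
        ; trans         = P.trans
        }
      ; antisym = λ x≤y y≤x → f-inj (P.antisym x≤y y≤x)
      }
    ; _≟_  = _≟_
    ; _≤?_ = λ x y → f x P.≤ₚ? f y
    }
  }
  where module P = POP p

inject-injective : ∀ {k} (i : Fin k) → Injective _≡_ _≡_ (inject {i = i})
inject-injective i {x} {y} eq = toℕ-injective
  (trans (sym (toℕ-inject x)) (trans (cong toℕ eq) (toℕ-inject y)))

-- The subposet induced by the labels strictly below i; it has toℕ i labels.
below : ∀ {k} → POP k → (i : Fin k) → POP (toℕ i)
below p i = induced (inject {i = i}) (inject-injective i) p

-- Equality, as labelled posets, of the subposets induced by the labels in S.
SameInducedOn : ∀ {k} → Pred (Fin k) 0ℓ → POP k → POP k → Set
SameInducedOn S p q = ∀ x y → S x → S y → (x ≤[ p ] y) ⇔ (x ≤[ q ] y)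

Increasing : ∀ {m n} → (Fin m → Fin n) → Set
Increasing f = f Preserves _<_ ⟶ _<_

------------------------------------------------------------------------
-- Permutations

IsPermutation : ∀ {n} → (Fin n → Fin n) → Set
IsPermutation π = Bijective _≡_ _≡_ π

IsOccurrence : ∀ {k n} → POP k → (Fin n → Fin n) → (Fin k → Fin n) → Set
IsOccurrence p π ι = Increasing ι × (∀ j m → j <[ p ] m → π (ι j) < π (ι m))

Contains : ∀ {k n} → POP k → (Fin n → Fin n) → Set
Contains p π = ∃[ ι ] IsOccurrence p π ι

Avoids : ∀ {k n} → POP k → (Fin n → Fin n) → Set
Avoids p π = ¬ Contains p π

------------------------------------------------------------------------
-- Ferrers boards and transversals

record FerrersBoard (n : ℕ) : Set where
  field
    row       : Fin n → ℕ
    antitone  : ∀ {i j} → i ≤ j → row j ℕ.≤ row i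
    positive  : ∀ i → 0 ℕ.< row i
    first-row : ∀ i → toℕ i ≡ 0 → row i ≡ n

InBoard : ∀ {n} → FerrersBoard n → Fin n → Fin n → Set
InBoard Λ i j = toℕ j ℕ.< FerrersBoard.row Λ i

-- A filling of the cells of a board inside the n × n square is represented
-- by its extension by 0 to the whole square; `T i j` is the entry in row i
-- and column j.
Filling : ℕ → Set
Filling n = Fin n → Fin n → Fin 2

record IsTransversal {n} (Λ : FerrersBoard n) (T : Filling n) : Set where
  constructor isTransversal
  field
    supported : ∀ i j → T i j ≡ 1F → InBoard Λ i j
    rows      : ∀ i → ∃! _≡_ (λ j → T i j ≡ 1F)
    columns   : ∀ j → ∃! _≡_ (λ i → T i j ≡ 1F)

IsBoardOccurrence : ∀ {m n} → POP m → FerrersBoard n → Filling n →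
                    (r c : Fin m → Fin n) (σ : Fin m → Fin m) → Set
IsBoardOccurrence p Λ T r c σ =
    Increasing r
  × Increasing c
  × (∀ a b → InBoard Λ (r a) (c b))
  × (∀ b → T (r (σ b)) (c b) ≡ 1F)
  × (∀ j m → j <[ p ] m → σ j < σ m)

BoardContains : ∀ {m n} → POP m → FerrersBoard n → Filling n → Set
BoardContains p Λ T = ∃[ r ] ∃[ c ] ∃[ σ ] IsBoardOccurrence p Λ T r c σ

BoardAvoids : ∀ {m n} → POP m → FerrersBoard n → Filling n → Set
BoardAvoids p Λ T = ¬ BoardContains p Λ T

------------------------------------------------------------------------
-- Decidability

anyFun? : ∀ {m n} {P : Pred (Fin m → Fin n) 0ℓ} →
          (∀ {f g} → f ≗ g → P f → P g) → Decidable P → Dec (∃ P)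
anyFun? resp P? = map′
  (λ (c , Pc) → finToFun c , Pc)
  (λ (f , Pf) → funToFin f , resp (sym ∘ finToFun-funToFin f) Pf)
  (any? (P? ∘ finToFun))

∃!? : ∀ {n} {P : Pred (Fin n) 0ℓ} → Decidable P → Dec (∃! _≡_ P)
∃!? P? = map′
  (λ (x , Px , u) → x , Px , λ {y} → u y)
  (λ (x , Px , u) → x , Px , λ y → u {y})
  (any? λ x → P? x ×-dec all? λ y → P? y →-dec x ≟ y)

increasing? : ∀ {m n} → Decidable (Increasing {m} {n})
increasing? f = map′ (λ h {x} {y} → h x y) (λ h x y → h {x} {y})
  (all? λ x → all? λ y → x <? y →-dec f x <? f y)

increasing-resp : ∀ {m n} {f g : Fin m → Fin n} → f ≗ g → Increasing f → Increasing g
increasing-resp f≗g inc {x} {y} x<y = subst₂ _<_ (f≗g x) (f≗g y) (inc x<y)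

isPermutation? : ∀ {n} → Decidable (IsPermutation {n})
isPermutation? π = injective? ×-dec surjective?
  where
  injective? = map′ (λ h {x} {y} → h x y) (λ h x y → h {x} {y})
    (all? λ x → all? λ y → π x ≟ π y →-dec x ≟ y)
  surjective? = map′ strictlySurjective⇒surjective surjective⇒strictlySurjective
    (all? λ y → any? λ x → π x ≟ y)

contains? : ∀ {k n} (p : POP k) → Decidable (Contains {k} {n} p)
contains? p π = anyFun?
  (λ f≗g (inc , h) → increasing-resp f≗g inc ,
    λ j m j<m → subst₂ _<_ (cong π (f≗g j)) (cong π (f≗g m)) (h j m j<m))
  (λ ι → increasing? ι ×-dec
    all? λ j → all? λ m → (j <ₚ? m) →-dec π (ι j) <? π (ι m))
  where open POP p using (_<ₚ?_)

avoids? : ∀ {k n} (p : POP k) → Decidable (Avoids {k} {n} p)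
avoids? p π = ¬? (contains? p π)

inBoard? : ∀ {n} (Λ : FerrersBoard n) i j → Dec (InBoard Λ i j)
inBoard? Λ i j = toℕ j ℕ.<? FerrersBoard.row Λ i

isTransversal? : ∀ {n} (Λ : FerrersBoard n) → Decidable (IsTransversal Λ)
isTransversal? Λ T = map′
  (λ (s , r , c) → isTransversal s r c)
  (λ (isTransversal s r c) → s , r , c)
  (    (all? λ i → all? λ j → T i j ≟ 1F →-dec inBoard? Λ i j)
  ×-dec (all? λ i → ∃!? λ j → T i j ≟ 1F)
  ×-dec (all? λ j → ∃!? λ i → T i j ≟ 1F))

isBoardOccurrence-resp : ∀ {m n} (p : POP m) (Λ : FerrersBoard n) (T : Filling n) {r r′ c c′ σ σ′} →
  r ≗ r′ → c ≗ c′ → σ ≗ σ′ → IsBoardOccurrence p Λ T r c σ → IsBoardOccurrence p Λ T r′ c′ σ′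
isBoardOccurrence-resp p Λ T {r} r≗ c≗ σ≗ (ri , ci , cells , ones , ord) =
    increasing-resp r≗ ri
  , increasing-resp c≗ ci
  , (λ a b → subst₂ (InBoard Λ) (r≗ a) (c≗ b) (cells a b))
  , (λ b → subst₂ (λ i j → T i j ≡ 1F) (trans (cong r (σ≗ b)) (r≗ _)) (c≗ b) (ones b))
  , (λ j m j<m → subst₂ _<_ (σ≗ j) (σ≗ m) (ord j m j<m))

boardContains? : ∀ {m n} (p : POP m) (Λ : FerrersBoard n) → Decidable (BoardContains p Λ)
boardContains? p Λ T =
  anyFun? (λ e (c , σ , h) → c , σ , resp e (λ _ → refl) (λ _ → refl) h) λ r →
  anyFun? (λ e (σ , h) → σ , resp (λ _ → refl) e (λ _ → refl) h) λ c →
  anyFun? (resp (λ _ → refl) (λ _ → refl)) λ σ →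
    increasing? r ×-dec
    increasing? c ×-dec
    (all? λ a → all? λ b → inBoard? Λ (r a) (c b)) ×-dec
    (all? λ b → T (r (σ b)) (c b) ≟ 1F) ×-dec
    (all? λ j → all? λ m → (j <ₚ? m) →-dec σ j <? σ m)
  where
  open POP p using (_<ₚ?_)
  resp = λ {r} {r′} {c} {c′} {σ} {σ′} → isBoardOccurrence-resp p Λ T {r} {r′} {c} {c′} {σ} {σ′}

boardAvoids? : ∀ {m n} (p : POP m) (Λ : FerrersBoard n) → Decidable (BoardAvoids p Λ)
boardAvoids? p Λ T = ¬? (boardContains? p Λ T)

------------------------------------------------------------------------
-- Counting and Wilf-equivalences

-- finToFun is a bijection (up to pointwise equality) from Fin (m ^ n) to
-- Fin n → Fin m, so each of the two lists below contains every function of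
-- its type exactly once up to pointwise equality.

words : ∀ n → List (Fin n → Fin n)
words n = map finToFun (allFin (n ^ n))

fillings : ∀ n → List (Filling n)
fillings n = map (λ c i → finToFun (finToFun c i)) (allFin ((2 ^ n) ^ n))

#avoiding : ∀ {k} → ℕ → POP k → ℕ
#avoiding n p = length (filter (λ π → isPermutation? π ×-dec avoids? p π) (words n))

#transversals : ∀ {m n} → FerrersBoard n → POP m → ℕ
#transversals {n = n} Λ p =
  length (filter (λ T → isTransversal? Λ T ×-dec boardAvoids? p Λ T) (fillings n))

infix 4 _∼_ _∼ₛ_

_∼_ : ∀ {k l} → POP k → POP l → Set
p ∼ q = ∀ n → 1 ℕ.≤ n → #avoiding n p ≡ #avoiding n q

_∼ₛ_ : ∀ {k l} → POP k → POP l → Set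
p ∼ₛ q = ∀ n → 1 ℕ.≤ n → (Λ : FerrersBoard n) → #transversals Λ p ≡ #transversals Λ q

{-# OPTIONS --safe #-}

-- Call a cell (v , c) of the diagram of π good if the labels ≥ i₁ can be
-- embedded in the columns to the right of c, with the non-isolated ones in
-- the prescribed order and above row v. The good cells are closed under
-- moving down and left, and π contains p exactly when the entries of π in
-- good cells contain the part of p below i₁ within a rectangle of good
-- cells. A witness for a good cell that is pushed as far to the upper right
-- as possible uses no entry in a good cell, so the good region depends only
-- on the entries outside it. Fix the region and these entries and delete
-- their rows and columns: what remains is a Ferrers board, whose
-- transversals are the permutations of the class. Shape-Wilf equivalence
-- applies on each class. If i₁ is the least label, there is no lower part,
-- and p and p′ have the same strict order.

module Submission where

open import Defs
open import Data.Nat.Base using (ℕ)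
open import Data.Fin.Base using (Fin; _≤_; _<_)
open import Data.Product.Base using (_×_)
open import Function.Bundles using (_⇔_)
open import Relation.Nullary.Negation using (¬_)

open import Data.Fin.Base using (zero; suc; toℕ; fromℕ; fromℕ<; inject; combine; finToFun; funToFin; _>_)
open import Data.Fin.Induction using (>-wellFounded)
open import Data.Fin.Patterns using (0F; 1F; 2F)
open import Data.Fin.Properties using (_≟_; _<?_; _≤?_; any?; all?; ¬Fin0; toℕ<n; toℕ-injective; toℕ-fromℕ<; toℕ-inject; ≤fromℕ; <-cmp; <⇒≢; injective⇒≤; funToFin-finToFin; finToFun-funToFin)
open import Data.List.Base using (List; []; _∷_; allFin; filter; length; tabulate)
open import Data.List.Properties using (filter-≐; filter-none; map-tabulate)
import Data.List.Relation.Unary.All as All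
open import Data.List.Relation.Unary.All.Properties using (¬Any⇒All¬)
open import Data.List.Relation.Unary.Any as Any using (Any)
open import Data.Nat.Base as ℕ using (zero; suc; _+_; _^_; z≤n; s≤s; s<s; z<s)
import Data.Nat.Properties as ℕ
open import Data.Product.Base using (∃; ∃-syntax; Σ-syntax; _,_; proj₁; proj₂)
open import Data.Sum.Base as Sum using (_⊎_; inj₁; inj₂)
open import Data.Unit.Base using (⊤; tt)
open import Function.Base using (_∘_; id)
open import Function.Bundles using (mk⇔; module Equivalence)
open import Function.Consequences.Propositional using (strictlySurjective⇒surjective; surjective⇒strictlySurjective)
open import Function.Definitions using (Injective)
open import Induction.WellFounded using (Acc; acc)
open import Level using (0ℓ)
open import Relation.Binary.Core using (Rel)
import Relation.Binary.Definitions as Binary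
open import Relation.Binary.Definitions using (tri<; tri≈; tri>)
open import Relation.Binary.PropositionalEquality using (_≡_; _≢_; _≗_; refl; sym; trans; cong; cong₂; subst; subst₂; module ≡-Reasoning)
open import Relation.Nullary.Decidable using (Dec; yes; no; _×-dec_; _→-dec_; _⊎-dec_; ¬?; map′; decidable-stable)
open import Relation.Nullary.Negation using (contradiction)
open import Relation.Unary using (Pred; Decidable)

open Equivalence using (to; from)

-- Increasing maps between finite ordinals.

increasing⇒injective : ∀ {m n} {f : Fin m → Fin n} → Increasing f → Injective _≡_ _≡_ f
increasing⇒injective inc {x} {y} eq with <-cmp x y
... | tri< x<y _ _ = contradiction eq (<⇒≢ (inc x<y))
... | tri≈ _ x≡y _ = x≡y
... | tri> _ _ y<x = contradiction (sym eq) (<⇒≢ (inc y<x))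

increasing-cancel-< : ∀ {m n} {f : Fin m → Fin n} → Increasing f → ∀ {x y} → f x < f y → x < y
increasing-cancel-< inc {x} {y} fx<fy with <-cmp x y
... | tri< x<y _ _ = x<y
... | tri≈ _ refl _ = contradiction fx<fy (ℕ.<-irrefl refl)
... | tri> _ _ y<x = contradiction fx<fy (ℕ.<-asym (inc y<x))

increasing-mono-≤ : ∀ {m n} {f : Fin m → Fin n} → Increasing f → ∀ {x y} → x ≤ y → f x ≤ f y
increasing-mono-≤ inc {x} {y} x≤y with <-cmp x y
... | tri< x<y _ _ = ℕ.<⇒≤ (inc x<y)
... | tri≈ _ refl _ = ℕ.≤-refl
... | tri> _ _ y<x = contradiction x≤y (ℕ.<⇒≱ y<x)

-- Increasing enumerations and counting by matching.

record Enumeration {n} (P : Pred (Fin n) 0ℓ) (a : ℕ) : Set where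
  field
    elem       : Fin a → Fin n
    increasing : Increasing elem
    satisfies  : ∀ i → P (elem i)
    index      : ∀ x → P x → Fin a
    elem-index : ∀ x px → elem (index x px) ≡ x

  injective : Injective _≡_ _≡_ elem
  injective = increasing⇒injective increasing

-- The size is the length of a filtered list, so that it is literally a value of `count`.
-- Enumerating positions along `f` makes it possible to count functions by their codes, on which
-- equality is propositional.
enumerate : ∀ {A : Set} {P : Pred A 0ℓ} (P? : Decidable P) {n} (f : Fin n → A) →
            Enumeration (P ∘ f) (length (filter P? (tabulate f)))
enumerate P? {zero} f = record
  { elem = λ () ; increasing = λ { {()} } ; satisfies = λ () ; index = λ () ; elem-index = λ () }
enumerate {P = P} P? {suc n} f with P? (f zero) | enumerate P? (f ∘ suc)
... | yes p₀ | E = record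
  { elem       = elem′
  ; increasing = increasing′
  ; satisfies  = λ { zero → p₀ ; (suc i) → E.satisfies i }
  ; index      = λ { zero _ → zero ; (suc x) px → suc (E.index x px) }
  ; elem-index = λ { zero _ → refl ; (suc x) px → cong suc (E.elem-index x px) }
  }
  where
  module E = Enumeration E
  elem′ : Fin _ → Fin (suc n)
  elem′ zero    = zero
  elem′ (suc i) = suc (E.elem i)
  increasing′ : Increasing elem′
  increasing′ {zero}  {suc y} _         = z<s
  increasing′ {suc x} {suc y} (s<s x<y) = s<s (E.increasing x<y)
... | no ¬p₀ | E = record
  { elem       = suc ∘ E.elem
  ; increasing = s<s ∘ E.increasing
  ; satisfies  = E.satisfies
  ; index      = λ { zero p₀ → contradiction p₀ ¬p₀ ; (suc x) px → E.index x px }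
  ; elem-index = λ { zero p₀ → contradiction p₀ ¬p₀ ; (suc x) px → cong suc (E.elem-index x px) }
  }
  where module E = Enumeration E

-- Choosing partners is injective by uniqueness, so the pigeonhole principle applies. A relation
-- fits better than a map here, since a permutation and its transversal are linked by a
-- specification.
matching⇒≤ : ∀ {m n a b} {P : Pred (Fin m) 0ℓ} {Q : Pred (Fin n) 0ℓ} (_R_ : Fin m → Fin n → Set) →
  Enumeration P a → Enumeration Q b →
  (∀ x → P x → ∃[ y ] (Q y × x R y)) →
  (∀ {x x′ y} → P x → P x′ → x R y → x′ R y → x ≡ x′) →
  a ℕ.≤ b
matching⇒≤ _R_ E F match unique = injective⇒≤ {f = f} f-injective
  where
  module E = Enumeration E
  module F = Enumeration F
  partner = λ i → match (E.elem i) (E.satisfies i)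
  f = λ i → F.index (proj₁ (partner i)) (proj₁ (proj₂ (partner i)))
  elem-f : ∀ i → F.elem (f i) ≡ proj₁ (partner i)
  elem-f i = F.elem-index _ _
  f-injective : Injective _≡_ _≡_ f
  f-injective {i} {j} eq = E.injective
    (unique (E.satisfies i) (E.satisfies j) (proj₂ (proj₂ (partner i)))
      (subst (E.elem j R_) (trans (sym (elem-f j)) (trans (cong F.elem (sym eq)) (elem-f i)))
        (proj₂ (proj₂ (partner j)))))

matching⇒≡ : ∀ {m n a b} {P : Pred (Fin m) 0ℓ} {Q : Pred (Fin n) 0ℓ} (_R_ : Fin m → Fin n → Set) →
  Enumeration P a → Enumeration Q b →
  (∀ x → P x → ∃[ y ] (Q y × x R y)) →
  (∀ y → Q y → ∃[ x ] (P x × x R y)) →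
  (∀ {x x′ y} → P x → P x′ → x R y → x′ R y → x ≡ x′) →
  (∀ {x y y′} → Q y → Q y′ → x R y → x R y′ → y ≡ y′) →
  a ≡ b
matching⇒≡ _R_ E F l r ul ur = ℕ.≤-antisym
  (matching⇒≤ _R_ E F l ul) (matching⇒≤ (λ y x → x R y) F E r ur)

-- Counting in lists.

module _ {A : Set} where

  count : {P : Pred A 0ℓ} → Decidable P → List A → ℕ
  count P? xs = length (filter P? xs)

  count-cong : {P Q : Pred A 0ℓ} (P? : Decidable P) (Q? : Decidable Q) →
               (∀ x → P x ⇔ Q x) → ∀ xs → count P? xs ≡ count Q? xs
  count-cong P? Q? P⇔Q xs = cong length (filter-≐ P? Q?
    ((λ {x} → to (P⇔Q x)) , (λ {x} → from (P⇔Q x))) xs)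

  count-⊎ : {P Q R : Pred A 0ℓ} (P? : Decidable P) (Q? : Decidable Q) (R? : Decidable R) →
            (∀ x → P x ⇔ (Q x ⊎ R x)) → (∀ x → Q x → ¬ R x) →
            ∀ xs → count P? xs ≡ count Q? xs + count R? xs
  count-⊎ P? Q? R? P⇔Q⊎R disjoint []       = refl
  count-⊎ P? Q? R? P⇔Q⊎R disjoint (x ∷ xs) with P? x | Q? x | R? x | count-⊎ P? Q? R? P⇔Q⊎R disjoint xs
  ... | yes _  | yes _  | no _   | IH = cong suc IH
  ... | yes _  | no _   | yes _  | IH = trans (cong suc IH) (sym (ℕ.+-suc _ _))
  ... | no _   | no _   | no _   | IH = IH
  ... | _      | yes qx | yes rx | IH = contradiction rx (disjoint x qx)
  ... | no ¬px | yes qx | no _   | IH = contradiction (from (P⇔Q⊎R x) (inj₁ qx)) ¬px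
  ... | no ¬px | no _   | yes rx | IH = contradiction (from (P⇔Q⊎R x) (inj₂ rx)) ¬px
  ... | yes px | no ¬qx | no ¬rx | IH with to (P⇔Q⊎R x) px
  ...   | inj₁ qx = contradiction qx ¬qx
  ...   | inj₂ rx = contradiction rx ¬rx

  count-none : {P Q : Pred A 0ℓ} (P? : Decidable P) → (∀ {x} → P x → Q x) →
               ∀ {xs} → ¬ Any Q xs → count P? xs ≡ 0
  count-none P? P⇒Q ¬any = cong length (filter-none P? (All.map (_∘ P⇒Q) (¬Any⇒All¬ _ ¬any)))

  module _ {P Q : Pred A 0ℓ} (P? : Decidable P) (Q? : Decidable Q) (key : A → ℕ) (xs : List A)
           (fibre : ∀ b → count (λ x → P? x ×-dec (key x ℕ.≟ b)) xs ≡ count (λ x → Q? x ×-dec (key x ℕ.≟ b)) xs)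
           where

    private
      split : ∀ {S : Pred A 0ℓ} (S? : Decidable S) b →
              count (λ x → S? x ×-dec (key x ℕ.<? suc b)) xs
              ≡ count (λ x → S? x ×-dec (key x ℕ.<? b)) xs + count (λ x → S? x ×-dec (key x ℕ.≟ b)) xs
      split S? b = count-⊎ _ _ _
        (λ x → mk⇔ (λ { (sx , s≤s k≤b) → Sum.map (sx ,_) (sx ,_) (ℕ.m≤n⇒m<n∨m≡n k≤b) })
                   (λ { (inj₁ (sx , k<b)) → sx , ℕ.m<n⇒m<1+n k<b ; (inj₂ (sx , refl)) → sx , ℕ.≤-refl }))
        (λ { x (_ , k<b) (_ , refl) → ℕ.<-irrefl refl k<b }) xs

      -- Induction on the bound: raising it by one adds exactly the fibre over the old bound, where
      -- the two counts agree.
      count-key<-≡ : ∀ b → count (λ x → P? x ×-dec (key x ℕ.<? b)) xs ≡ count (λ x → Q? x ×-dec (key x ℕ.<? b)) xs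
      count-key<-≡ zero    = count-cong _ _ (λ x → mk⇔ (λ ()) (λ ())) xs
      count-key<-≡ (suc b) = trans (split P? b)
        (trans (cong₂ _+_ (count-key<-≡ b) (fibre b)) (sym (split Q? b)))

    count-≡-by-fibres : ∀ b → (∀ x → key x ℕ.< b) → count P? xs ≡ count Q? xs
    count-≡-by-fibres b key<b = trans
      (count-cong P? _ (λ x → mk⇔ (_, key<b x) proj₁) xs)
      (trans (count-key<-≡ b) (count-cong _ Q? (λ x → mk⇔ proj₁ (_, key<b x)) xs))

-- Codes for functions, initial segments and sorting.

funToFin-cong : ∀ {m n} {f g : Fin m → Fin n} → f ≗ g → funToFin f ≡ funToFin g
funToFin-cong {zero}  f≗g = refl
funToFin-cong {suc m} f≗g = cong₂ combine (f≗g zero) (funToFin-cong (f≗g ∘ suc))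

finToFun-injective : ∀ {m n} {x y : Fin (n ^ m)} → finToFun {n} {m} x ≗ finToFun y → x ≡ y
finToFun-injective {m} {n} {x} {y} eq =
  trans (sym (funToFin-finToFin {m} {n} x)) (trans (funToFin-cong eq) (funToFin-finToFin {m} {n} y))

encode₂ : ∀ {a b c} → (Fin a → Fin b → Fin c) → Fin ((c ^ b) ^ a)
encode₂ f = funToFin (funToFin ∘ f)

-- For `c` equal to 2 and `a` equal to `b`, this is the function that `fillings` maps over all
-- codes.
decode₂ : ∀ {a b c} → Fin ((c ^ b) ^ a) → Fin a → Fin b → Fin c
decode₂ x i = finToFun (finToFun x i)

encode₂-cong : ∀ {a b c} {f g : Fin a → Fin b → Fin c} → (∀ i j → f i j ≡ g i j) → encode₂ f ≡ encode₂ g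
encode₂-cong f≗g = funToFin-cong (λ i → funToFin-cong (f≗g i))

decode₂-encode₂ : ∀ {a b c} (f : Fin a → Fin b → Fin c) → ∀ i j → decode₂ (encode₂ f) i j ≡ f i j
decode₂-encode₂ f i j = trans (cong (λ x → finToFun x j) (finToFun-funToFin (funToFin ∘ f) i))
                              (finToFun-funToFin (f i) j)

decode₂-injective : ∀ {a b c} {x y : Fin ((c ^ b) ^ a)} →
                    (∀ i j → decode₂ {a} {b} {c} x i j ≡ decode₂ y i j) → x ≡ y
decode₂-injective eq = finToFun-injective (λ i → finToFun-injective (eq i))

-- Meaningful for downward closed D only: it counts up to the first failure of D.
prefix : ∀ {a} {D : Pred (Fin a) 0ℓ} → Decidable D → ℕ
prefix {zero}  D? = 0
prefix {suc a} D? with D? zero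
... | yes _ = suc (prefix (D? ∘ suc))
... | no  _ = 0

prefix-≤ : ∀ {a} {D : Pred (Fin a) 0ℓ} (D? : Decidable D) → prefix D? ℕ.≤ a
prefix-≤ {zero}  D? = z≤n
prefix-≤ {suc a} D? with D? zero
... | yes _ = s≤s (prefix-≤ (D? ∘ suc))
... | no  _ = z≤n

<prefix⇒ : ∀ {a} {D : Pred (Fin a) 0ℓ} (D? : Decidable D) j → toℕ j ℕ.< prefix D? → D j
<prefix⇒ {suc a} D? j j< with D? zero
<prefix⇒ {suc a} D? zero    j<       | yes d₀ = d₀
<prefix⇒ {suc a} D? (suc j) (s<s j<) | yes d₀ = <prefix⇒ (D? ∘ suc) j j<

⇒<prefix : ∀ {a} {D : Pred (Fin a) 0ℓ} (D? : Decidable D) → (∀ {i j} → i ≤ j → D j → D i) →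
           ∀ j → D j → toℕ j ℕ.< prefix D?
⇒<prefix {suc a} D? down j dj with D? zero
⇒<prefix {suc a} D? down zero    dj | yes _  = z<s
⇒<prefix {suc a} D? down (suc j) dj | yes _  = s<s (⇒<prefix (D? ∘ suc) (λ i≤j → down (s≤s i≤j)) j dj)
⇒<prefix {suc a} D? down j       dj | no ¬d₀ = contradiction (down z≤n dj) ¬d₀

-- Here `r` enumerates the image of `f`, which has `m` elements by injectivity, and `σ b` is the
-- rank of `f b`. This turns the rows met by the columns of an occurrence into the data of a board
-- occurrence.
sort : ∀ {m a} (f : Fin m → Fin a) → Injective _≡_ _≡_ f →
       ∃[ r ] ∃[ σ ] (Increasing r × (∀ (x : Fin m) → ∃[ b ] f b ≡ r x) × (∀ b → r (σ b) ≡ f b))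
sort {m} {a} f f-inj = E.elem , (λ b → E.index (f b) (b , refl)) , E.increasing , E.satisfies , λ b → E.elem-index _ _
  where
  image? : Decidable (λ v → ∃[ b ] f b ≡ v)
  image? v = any? λ b → f b ≟ v
  full : Enumeration (λ (_ : Fin m) → ⊤) m
  full = record { elem = id ; increasing = id ; satisfies = _ ; index = λ x _ → x ; elem-index = λ _ _ → refl }
  size≡ : length (filter image? (allFin a)) ≡ m
  size≡ = matching⇒≡ (λ v b → f b ≡ v) (enumerate image? id) full
    (λ { v (b , eq) → b , tt , eq }) (λ b _ → f b , (b , refl) , refl)
    (λ { _ _ refl refl → refl }) (λ { _ _ refl eq → f-inj (sym eq) })
  module E = Enumeration (subst (Enumeration _) size≡ (enumerate image? id))

-- The labels below `i₁` and the tail above them.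

greatest : ∀ {m} → 0 ℕ.< m → Σ[ t ∈ Fin m ] (∀ (b : Fin m) → b ≤ t)
greatest {suc m} _ = fromℕ m , ≤fromℕ

inject-< : ∀ {k} {i : Fin k} (b : Fin (toℕ i)) → inject {i = i} b < i
inject-< {i = i} b = subst (ℕ._< toℕ i) (sym (toℕ-inject b)) (toℕ<n b)

inject-increasing : ∀ {k} (i : Fin k) → Increasing (inject {i = i})
inject-increasing i {x} {y} = subst₂ ℕ._<_ (sym (toℕ-inject x)) (sym (toℕ-inject y))

inject-fromℕ< : ∀ {k} {i x : Fin k} (x<i : x < i) → inject {i = i} (fromℕ< x<i) ≡ x
inject-fromℕ< x<i = toℕ-injective (trans (toℕ-inject (fromℕ< x<i)) (toℕ-fromℕ< x<i))

-- What the bijection uses of a pattern. Since `p` and `p′` satisfy it with the same `S` and `R`,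
-- everything built from `S` and `R` alone is common to both.
record SplitsAt {k} (i₁ : Fin k) (S : Pred (Fin k) 0ℓ) (R : Rel (Fin k) 0ℓ) (p : POP k) : Set where
  field
    below-tail : ∀ {x y} → x < i₁ → S y → x <[ p ] y
    tail-order : ∀ {x y} → S x → S y → (x <[ p ] y) ⇔ R x y
    cases      : ∀ {x y} → x <[ p ] y → (x < i₁ × y < i₁) ⊎ (x < i₁ × S y) ⊎ (S x × S y)

-- Good cells and the trace of a permutation.

module Tail {k} (i₁ : Fin k) {S : Pred (Fin k) 0ℓ} (S? : Decidable S) (S⇒≥ : ∀ {x} → S x → i₁ ≤ x)
            {R : Rel (Fin k) 0ℓ} (R? : Binary.Decidable R) {n : ℕ} where

  -- Labels below i₁ are in the domain of ι only to avoid reindexing: no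
  -- condition mentions them.
  record IsTailOccurrence (π : Fin n → Fin n) (v c : Fin n) (ι : Fin k → Fin n) : Set where
    constructor isTailOccurrence
    field
      increasing : ∀ x y → i₁ ≤ x → x < y → ι x < ι y
      right      : ∀ x → i₁ ≤ x → c < ι x
      above      : ∀ x → S x → v < π (ι x)
      ordered    : ∀ x y → S x → S y → R x y → π (ι x) < π (ι y)

  record Good (π : Fin n → Fin n) (v c : Fin n) : Set where
    constructor good
    field
      {embedding}    : Fin k → Fin n
      tailOccurrence : IsTailOccurrence π v c embedding

  -- Opaque, since only the decision matters and never the search over all embeddings that yields
  -- it.
  abstract
    good? : ∀ π v c → Dec (Good π v c)
    good? π v c = map′ (λ (ι , inc , rt , ab , ord) → good (isTailOccurrence inc rt ab ord))
      (λ (good {ι} (isTailOccurrence inc rt ab ord)) → ι , inc , rt , ab , ord)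
      (anyFun?
        (λ {f} {g} f≗g (inc , right , above , ord) →
            (λ x y h x<y → subst₂ _<_ (f≗g x) (f≗g y) (inc x y h x<y))
          , (λ x h → subst (c <_) (f≗g x) (right x h))
          , (λ x s → subst (v <_) (cong π (f≗g x)) (above x s))
          , (λ x y s t r → subst₂ _<_ (cong π (f≗g x)) (cong π (f≗g y)) (ord x y s t r)))
        (λ ι →
          (all? λ x → all? λ y → i₁ ≤? x →-dec x <? y →-dec ι x <? ι y)
          ×-dec (all? λ x → i₁ ≤? x →-dec c <? ι x)
          ×-dec (all? λ x → S? x →-dec v <? π (ι x))
          ×-dec (all? λ x → all? λ y → S? x →-dec S? y →-dec R? x y →-dec π (ι x) <? π (ι y))))

  good-down : ∀ {π v v′ c c′} → v′ ≤ v → c′ ≤ c → Good π v c → Good π v′ c′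
  good-down v′≤v c′≤c (good (isTailOccurrence inc right above ord)) = good (isTailOccurrence
    inc (λ x h → ℕ.≤-<-trans c′≤c (right x h)) (λ x s → ℕ.≤-<-trans v′≤v (above x s)) ord)

  -- Terminates because a good entry of the witness lies strictly further to
  -- the right, and can replace the given cell.
  outer-witness : ∀ {π v c} → Good π v c →
    ∃[ v′ ] ∃[ c′ ] ∃[ ι ] (v ≤ v′ × c ≤ c′ × IsTailOccurrence π v′ c′ ι
      × (∀ x → S x → ¬ Good π (π (ι x)) (ι x)))
  outer-witness {π} {v} {c} = go (>-wellFounded c)
    where
    go : ∀ {v c} → Acc _>_ c → Good π v c →
      ∃[ v′ ] ∃[ c′ ] ∃[ ι ] (v ≤ v′ × c ≤ c′ × IsTailOccurrence π v′ c′ ι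
        × (∀ x → S x → ¬ Good π (π (ι x)) (ι x)))
    go {v} {c} (acc rs) (good {ι} occ@(isTailOccurrence inc right above ord))
      with any? (λ x → S? x ×-dec good? π (π (ι x)) (ι x))
    ... | no ¬good = v , c , ι , ℕ.≤-refl , ℕ.≤-refl , occ , λ x s g → ¬good (x , s , g)
    ... | yes (x , s , g) with go (rs (right x (S⇒≥ s))) g
    ...   | v′ , c′ , ι′ , v≤ , c≤ , rest =
      v′ , c′ , ι′ , ℕ.≤-trans (ℕ.<⇒≤ (above x s)) v≤ , ℕ.≤-trans (ℕ.<⇒≤ (right x (S⇒≥ s))) c≤ , rest

  transfer : ∀ {π π′ v c ι} → (∀ x → S x → π (ι x) ≡ π′ (ι x)) →
             IsTailOccurrence π v c ι → IsTailOccurrence π′ v c ι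
  transfer {v = v} eq (isTailOccurrence inc right above ord) = isTailOccurrence
    inc right (λ x s → subst (v <_) (eq x s) (above x s))
    (λ x y s t r → subst₂ _<_ (eq x s) (eq y t) (ord x y s t r))

  -- Only the good region of `π₀` is mentioned; that `π` has the same region is a consequence,
  -- proved next.
  AgreeOutside : (π₀ π : Fin n → Fin n) → Set
  AgreeOutside π₀ π = ∀ v c → ¬ Good π₀ v c → (π₀ c ≡ v) ⇔ (π c ≡ v)

  -- An outer witness for `π₀` has its entries at labels in `S` outside the good region of `π₀`,
  -- where `π` agrees, so it also serves `π`. Conversely, such entries of an outer witness for `π`
  -- avoid the good cells of `π`, hence by the first direction those of `π₀`, and agreement applies
  -- again.
  agree⇒good⇔ : ∀ {π₀ π} → AgreeOutside π₀ π → ∀ v c → Good π₀ v c ⇔ Good π v c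
  agree⇒good⇔ {π₀} {π} agree v c = mk⇔ ⇒ ⇐
    where
    ⇒ : ∀ {v c} → Good π₀ v c → Good π v c
    ⇒ g with outer-witness g
    ... | v′ , c′ , ι , v≤ , c≤ , occ , out =
      good-down v≤ c≤ (good (transfer (λ x s → sym (to (agree _ _ (out x s)) refl)) occ))
    ⇐ : ∀ {v c} → Good π v c → Good π₀ v c
    ⇐ g with outer-witness g
    ... | v′ , c′ , ι , v≤ , c≤ , occ , out =
      good-down v≤ c≤ (good (transfer (λ x s → sym (from (agree _ _ (out x s ∘ ⇒)) refl)) occ))

  -- The good region of π together with the entries of π outside it.
  trace : (Fin n → Fin n) → Fin n → Fin n → Fin 3
  trace π v c with good? π v c | π c ≟ v
  ... | yes _ | _     = 0F
  ... | no _  | yes _ = 1F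
  ... | no _  | no _  = 2F

  trace≡⇒agree : ∀ {π₀ π} → (∀ v c → trace π₀ v c ≡ trace π v c) → AgreeOutside π₀ π
  trace≡⇒agree {π₀} {π} eq v c ¬g with good? π₀ v c | π₀ c ≟ v | good? π v c | π c ≟ v | eq v c
  ... | yes g | _     | _     | _     | _  = contradiction g ¬g
  ... | no _  | yes e | no _  | yes f | _  = mk⇔ (λ _ → f) (λ _ → e)
  ... | no _  | no ¬e | no _  | no ¬f | _  = mk⇔ (λ e → contradiction e ¬e) (λ f → contradiction f ¬f)
  ... | no _  | yes _ | yes _ | _     | ()
  ... | no _  | yes _ | no _  | no _  | ()
  ... | no _  | no _  | yes _ | _     | ()
  ... | no _  | no _  | no _  | yes _ | ()

  agree⇒trace≡ : ∀ {π₀ π} → AgreeOutside π₀ π → ∀ v c → trace π₀ v c ≡ trace π v c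
  agree⇒trace≡ {π₀} {π} agree v c
    with good? π₀ v c | π₀ c ≟ v | good? π v c | π c ≟ v | agree⇒good⇔ agree v c | agree v c
  ... | yes _ | _     | yes _ | _     | _   | _ = refl
  ... | no _  | yes _ | no _  | yes _ | _   | _ = refl
  ... | no _  | no _  | no _  | no _  | _   | _ = refl
  ... | yes g | _     | no ¬h | _     | g⇔h | _ = contradiction (to g⇔h g) ¬h
  ... | no ¬g | _     | yes h | _     | g⇔h | _ = contradiction (from g⇔h h) ¬g
  ... | no ¬g | yes e | no _  | no ¬f | _   | a = contradiction (to (a ¬g) e) ¬f
  ... | no ¬g | no ¬e | no _  | yes f | _   | a = contradiction (from (a ¬g) f) ¬e

  -- The trace as a number, so that permutations can be sorted into classes by a bounded key. By the
  -- next two lemmas, equal keys mean agreement outside the good region.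
  key : (Fin n → Fin n) → ℕ
  key π = toℕ (encode₂ (trace π))

  key≡⇒agree : ∀ {π₀ π} → key π₀ ≡ key π → AgreeOutside π₀ π
  key≡⇒agree {π₀} {π} eq = trace≡⇒agree λ v c →
    trans (sym (decode₂-encode₂ (trace π₀) v c))
      (trans (cong (λ x → decode₂ x v c) (toℕ-injective eq)) (decode₂-encode₂ (trace π) v c))

  agree⇒key≡ : ∀ {π₀ π} → AgreeOutside π₀ π → key π₀ ≡ key π
  agree⇒key≡ agree = cong toℕ (encode₂-cong (agree⇒trace≡ agree))

  -- Good rows and columns, and the Ferrers board of a class.

  GoodColumn GoodRow : (Fin n → Fin n) → Pred (Fin n) 0ℓ
  GoodColumn π c = Good π (π c) c
  GoodRow π v = ∃[ c ] (π c ≡ v × Good π v c)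

  -- A permutation matches its good columns with its good rows, so one size serves both and the
  -- board fits in a square.
  goodEnumerations : ∀ {π} → IsPermutation π →
                     ∃[ size ] (Enumeration (GoodColumn π) size × Enumeration (GoodRow π) size)
  goodEnumerations {π} (π-injective , _) = _ , columns , subst (Enumeration _) size≡ rows
    where
    columns = enumerate (λ c → good? π (π c) c) id
    rows = enumerate (λ v → any? λ c → (π c ≟ v) ×-dec good? π v c) id
    size≡ = matching⇒≡ (λ v c → π c ≡ v) rows columns
      (λ { v (c , refl , g) → c , g , refl })
      (λ c g → π c , (c , refl , g) , refl)
      (λ { _ _ refl refl → refl })
      (λ { _ _ refl eq → π-injective (sym eq) })

  module Class {π₀ : Fin n → Fin n} (perm₀ : IsPermutation π₀) {size : ℕ}
               (columnEnumeration : Enumeration (GoodColumn π₀) size)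
               (rowEnumeration : Enumeration (GoodRow π₀) size) where

    π₀-injective : Injective _≡_ _≡_ π₀
    π₀-injective = proj₁ perm₀

    π₀⁻¹ : ∀ v → ∃[ c ] π₀ c ≡ v
    π₀⁻¹ = surjective⇒strictlySurjective (proj₂ perm₀)

    goodColumn? : Decidable (GoodColumn π₀)
    goodColumn? c = good? π₀ (π₀ c) c

    goodRow? : Decidable (GoodRow π₀)
    goodRow? v = any? λ c → (π₀ c ≟ v) ×-dec good? π₀ v c

    module C = Enumeration columnEnumeration
    module V = Enumeration rowEnumeration

    inRow? : ∀ i → Decidable (λ j → Good π₀ (V.elem i) (C.elem j))
    inRow? i j = good? π₀ (V.elem i) (C.elem j)

    -- Good cells are closed under moving left, so the good columns of a row form an initial segment
    -- and `InBoard` for this length means good.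
    rowLength : Fin size → ℕ
    rowLength i = prefix (inRow? i)

    <rowLength⇒good : ∀ {i j} → toℕ j ℕ.< rowLength i → Good π₀ (V.elem i) (C.elem j)
    <rowLength⇒good {i} {j} = <prefix⇒ (inRow? i) j

    good⇒<rowLength : ∀ {i j} → Good π₀ (V.elem i) (C.elem j) → toℕ j ℕ.< rowLength i
    good⇒<rowLength {i} {j} = ⇒<prefix (inRow? i)
      (λ i≤j → good-down ℕ.≤-refl (increasing-mono-≤ C.increasing i≤j)) j

    -- Were the row shorter than `m`, the column just past its end would be good and hence belong to
    -- the row.
    rowLength-≥ : ∀ {i m} → m ℕ.≤ size → (∀ j → toℕ j ℕ.< m → Good π₀ (V.elem i) (C.elem j)) → m ℕ.≤ rowLength i
    rowLength-≥ {i} {m} m≤size all-good = ℕ.≮⇒≥ λ l<m →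
      let l<size = ℕ.<-≤-trans l<m m≤size
          j≡l    = toℕ-fromℕ< l<size
      in ℕ.<-irrefl j≡l (good⇒<rowLength (all-good (fromℕ< l<size) (subst (ℕ._< m) (sym j≡l) l<m)))

    board : FerrersBoard size
    board = record
      { row       = rowLength
      ; antitone  = λ {i} {j} i≤j → rowLength-≥ (prefix-≤ (inRow? j)) λ x x< →
          good-down (increasing-mono-≤ V.increasing i≤j) ℕ.≤-refl (<rowLength⇒good x<)
      ; positive  = positive
      ; first-row = λ i i≡0 → ℕ.≤-antisym (prefix-≤ (inRow? i)) (rowLength-≥ ℕ.≤-refl λ j _ → first i i≡0 j)
      }
      where
      positive : ∀ i → 0 ℕ.< rowLength i
      -- A good row contains an entry in a good cell, and the column of that entry is good.
      positive i with V.satisfies i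
      ... | c , eq , g = ℕ.≤-<-trans z≤n (good⇒<rowLength
        (subst (Good π₀ (V.elem i)) (sym (C.elem-index c gc)) g))
        where gc = subst (λ v → Good π₀ v c) (sym eq) g
      first : ∀ i → toℕ i ≡ 0 → ∀ j → Good π₀ (V.elem i) (C.elem j)
      -- The entry of a good column lies in a good row, hence weakly above the lowest good row;
      -- moving down from it stays good.
      first i i≡0 j = good-down v≤ ℕ.≤-refl (C.satisfies j)
        where
        gr : GoodRow π₀ (π₀ (C.elem j))
        gr = C.elem j , refl , C.satisfies j
        v≤ : V.elem i ≤ π₀ (C.elem j)
        v≤ = subst (V.elem i ≤_) (V.elem-index _ gr)
          (increasing-mono-≤ V.increasing (subst (ℕ._≤ toℕ (V.index _ gr)) (sym i≡0) z≤n))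

    -- Permutations of the class and transversals of the board.

    Represents : (Fin n → Fin n) → Filling size → Set
    -- `T` is the part of `π` in the good rows and columns; in the other columns `π` copies `π₀`.
    Represents π T =
        (∀ i j → (T i j ≡ 1F) ⇔ (π (C.elem j) ≡ V.elem i))
      × (∀ c → ¬ GoodColumn π₀ c → π c ≡ π₀ c)

    encodeFilling : ∀ {π} → AgreeOutside π₀ π → ∃[ x ] Represents π (decode₂ x)
    encodeFilling {π} agree = encode₂ T , (λ i j → mk⇔
        (λ e → to (T-spec i j) (trans (sym (decode₂-encode₂ T i j)) e))
        (λ e → trans (decode₂-encode₂ T i j) (from (T-spec i j) e)))
      , λ c ¬g → to (agree _ c ¬g) refl
      where
      T : Filling size
      T i j with π (C.elem j) ≟ V.elem i
      ... | yes _ = 1F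
      ... | no _  = 0F
      T-spec : ∀ i j → (T i j ≡ 1F) ⇔ (π (C.elem j) ≡ V.elem i)
      T-spec i j with π (C.elem j) ≟ V.elem i
      ... | yes e = mk⇔ (λ _ → e) (λ _ → refl)
      ... | no ¬e = mk⇔ (λ ()) (λ e → contradiction e ¬e)

    encodeWord : ∀ {T} → IsTransversal board T → ∃[ x ] Represents (finToFun x) T
    encodeWord {T} trans-T = funToFin π , inside , outside
      where
      module T = IsTransversal trans-T
      π : Fin n → Fin n
      π c with goodColumn? c
      ... | yes g = V.elem (proj₁ (T.columns (C.index c g)))
      ... | no _  = π₀ c
      π-elem : ∀ j → π (C.elem j) ≡ V.elem (proj₁ (T.columns j))
      π-elem j with goodColumn? (C.elem j)
      ... | yes g = cong (λ x → V.elem (proj₁ (T.columns x))) (C.injective (C.elem-index _ g))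
      ... | no ¬g = contradiction (C.satisfies j) ¬g
      inside : ∀ i j → (T i j ≡ 1F) ⇔ (finToFun (funToFin π) (C.elem j) ≡ V.elem i)
      inside i j with T.columns j in eq
      ... | i′ , one , unique = mk⇔
        (λ e → trans (finToFun-funToFin π _) (trans (π-elem j) (cong V.elem (trans (cong proj₁ eq) (unique e)))))
        (λ e → subst (λ x → T x j ≡ 1F) (trans (sym (cong proj₁ eq))
          (V.injective (trans (sym (π-elem j)) (trans (sym (finToFun-funToFin π _)) e)))) one)
      outside : ∀ c → ¬ GoodColumn π₀ c → finToFun (funToFin π) c ≡ π₀ c
      outside c ¬g = trans (finToFun-funToFin π c) π-outside
        where
        π-outside : π c ≡ π₀ c
        π-outside with goodColumn? c
        ... | yes g = contradiction g ¬g
        ... | no _  = refl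

    module _ {π T} (perm : IsPermutation π) (agree : AgreeOutside π₀ π) (rep : Represents π T) where

      private
        -- An entry of `π` or `π₀` outside the good region is common to both. This gives a
        -- contradiction here, and with injectivity in the next two lemmas, so `π` matches the good
        -- columns of `π₀` with its good rows through good cells.
        good-entry : ∀ c → GoodColumn π₀ c → Good π₀ (π c) c
        good-entry c g = decidable-stable (good? π₀ (π c) c) λ ¬g →
          ¬g (subst (λ v → Good π₀ v c) (from (agree _ c ¬g) refl) g)

        goodRow-entry : ∀ c → GoodColumn π₀ c → GoodRow π₀ (π c)
        goodRow-entry c g with π₀⁻¹ (π c)
        ... | c′ , eq = c′ , eq , decidable-stable (good? π₀ (π c) c′) λ ¬g →
          ¬g (subst (Good π₀ (π c)) (sym (proj₁ perm (to (agree _ c′ ¬g) eq))) (good-entry c g))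

        goodColumn-preimage : ∀ {c v} → π c ≡ v → GoodRow π₀ v → GoodColumn π₀ c
        goodColumn-preimage {c} refl (c′ , eq , g) = decidable-stable (goodColumn? c) λ ¬g →
          ¬g (subst (λ x → Good π₀ (π₀ x) x) (π₀-injective (trans eq (to (agree _ c ¬g) refl)))
            (subst (λ v → Good π₀ v c′) (sym eq) g))

      represents⇒transversal : IsTransversal board T
      represents⇒transversal = isTransversal supported rows columns
        where
        supported : ∀ i j → T i j ≡ 1F → InBoard board i j
        supported i j one = good⇒<rowLength
          (subst (λ v → Good π₀ v (C.elem j)) (to (proj₁ rep i j) one) (good-entry _ (C.satisfies j)))
        rows : ∀ i → _
        rows i with surjective⇒strictlySurjective (proj₂ perm) (V.elem i)
        ... | c , eq = C.index c gc , from (proj₁ rep i _) (trans (cong π (C.elem-index c gc)) eq) ,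
          λ {j} one → C.injective (trans (C.elem-index c gc)
            (proj₁ perm (trans eq (sym (to (proj₁ rep i j) one)))))
          where gc = goodColumn-preimage eq (V.satisfies i)
        columns : ∀ j → _
        columns j = V.index _ gr , from (proj₁ rep _ j) (sym (V.elem-index _ gr)) ,
          λ {i} one → V.injective (trans (V.elem-index _ gr) (to (proj₁ rep i j) one))
          where gr = goodRow-entry (C.elem j) (C.satisfies j)

    module _ {π T} (trans-T : IsTransversal board T) (rep : Represents π T) where

      private module T = IsTransversal trans-T

      π-elem : ∀ j → π (C.elem j) ≡ V.elem (proj₁ (T.columns j))
      π-elem j = to (proj₁ rep _ j) (proj₁ (proj₂ (T.columns j)))

      π-column : ∀ {c} (g : GoodColumn π₀ c) → π c ≡ V.elem (proj₁ (T.columns (C.index c g)))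
      π-column {c} g = trans (cong π (sym (C.elem-index c g))) (π-elem _)

      -- In a column that is not good, `π` is `π₀`. In a good column both entries are good cells,
      -- the one of `π` because `T` is supported on the board, so neither can be at a cell that is
      -- not good.
      represents⇒agree : AgreeOutside π₀ π
      represents⇒agree v c ¬g with goodColumn? c
      ... | no ¬gc = mk⇔ (trans (proj₂ rep c ¬gc)) (trans (sym (proj₂ rep c ¬gc)))
      ... | yes gc = mk⇔ (λ { refl → contradiction gc ¬g })
        (λ { refl → contradiction
          (subst₂ (Good π₀) (sym (π-column gc)) (C.elem-index c gc)
            (<rowLength⇒good (T.supported _ _ (proj₁ (proj₂ (T.columns (C.index c gc))))))) ¬g })

      -- `T` matches the good columns with the good rows, and `π₀` matches the remaining columns
      -- with the remaining rows.
      represents⇒permutation : IsPermutation π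
      represents⇒permutation = injective , strictlySurjective⇒surjective surjective
        where
        separated : ∀ {c c′} → GoodColumn π₀ c → ¬ GoodColumn π₀ c′ → π c ≢ π c′
        separated {c} {c′} g ¬g′ eq with V.satisfies (proj₁ (T.columns (C.index c g)))
        ... | c″ , eq″ , g″ = ¬g′ (subst (GoodColumn π₀) (π₀-injective
          (trans eq″ (trans (sym (π-column g)) (trans eq (proj₂ rep c′ ¬g′)))))
          (subst (λ v → Good π₀ v c″) (sym eq″) g″))
        injective : Injective _≡_ _≡_ π
        injective {c} {c′} eq with goodColumn? c | goodColumn? c′
        ... | yes g | no ¬g′ = contradiction eq (separated g ¬g′)
        ... | no ¬g | yes g′ = contradiction (sym eq) (separated g′ ¬g)
        ... | no ¬g | no ¬g′ = π₀-injective (trans (sym (proj₂ rep c ¬g)) (trans eq (proj₂ rep c′ ¬g′)))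
        ... | yes g | yes g′ = trans (sym (C.elem-index c g)) (trans (cong C.elem j≡j′) (C.elem-index c′ g′))
          where
          j = C.index c g
          j′ = C.index c′ g′
          i≡i′ : proj₁ (T.columns j) ≡ proj₁ (T.columns j′)
          i≡i′ = V.injective (trans (sym (π-column g)) (trans eq (π-column g′)))
          j≡j′ : j ≡ j′
          j≡j′ = trans (sym (proj₂ (proj₂ (T.rows _)) (proj₁ (proj₂ (T.columns j)))))
            (proj₂ (proj₂ (T.rows _))
              (subst (λ i → T i j′ ≡ 1F) (sym i≡i′) (proj₁ (proj₂ (T.columns j′)))))
        surjective : ∀ v → ∃[ c ] π c ≡ v
        surjective v with goodRow? v
        ... | yes g = C.elem (proj₁ (T.rows (V.index v g))) ,
          trans (to (proj₁ rep _ _) (proj₁ (proj₂ (T.rows (V.index v g))))) (V.elem-index v g)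
        ... | no ¬g with π₀⁻¹ v
        ...   | c , refl = c , proj₂ rep c (λ g → ¬g (c , refl , g))

      represents-unique : ∀ {π′} → Represents π′ T → π ≗ π′
      represents-unique {π′} rep′ c with goodColumn? c
      ... | no ¬g = trans (proj₂ rep c ¬g) (sym (proj₂ rep′ c ¬g))
      ... | yes g = trans (π-column g) (trans
        (sym (to (proj₁ rep′ _ _) (proj₁ (proj₂ (T.columns (C.index c g)))))) (cong π′ (C.elem-index c g)))

    represented-unique : ∀ {π T T′} → Represents π T → Represents π T′ → ∀ i j → T i j ≡ T′ i j
    represented-unique {T = T} {T′} (spec , _) (spec′ , _) i j =
      same (λ e → from (spec′ i j) (to (spec i j) e)) (λ e → from (spec i j) (to (spec′ i j) e))
      where
      same : {x y : Fin 2} → (x ≡ 1F → y ≡ 1F) → (y ≡ 1F → x ≡ 1F) → x ≡ y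
      same {0F} {0F} _ _ = refl
      same {0F} {1F} _ g = g refl
      same {1F}      f _ = sym (f refl)

    -- Occurrences in the permutation and on the board.

    module _ {p : POP k} (splits : SplitsAt i₁ S R p) (0<i₁ : 0 ℕ.< toℕ i₁)
             {π T} (trans-T : IsTransversal board T) (rep : Represents π T) where

      private
        open SplitsAt splits
        module T = IsTransversal trans-T

        agree : AgreeOutside π₀ π
        agree = represents⇒agree trans-T rep

        <-inject⁺ : ∀ {x y} → x <[ below p i₁ ] y → inject x <[ p ] inject y
        <-inject⁺ (x≤y , x≢y) = x≤y , x≢y ∘ inject-injective i₁

        <-inject⁻ : ∀ {x y} → inject x <[ p ] inject y → x <[ below p i₁ ] y
        <-inject⁻ (x≤y , x≢y) = x≤y , x≢y ∘ cong inject

      contains⇒boardContains : Contains p π → BoardContains (below p i₁) board T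
      contains⇒boardContains (ι , ι-inc , ι-ord) = build (sort row row-injective)
        where
        col : Fin (toℕ i₁) → Fin n
        col b = ι (inject b)
        good-π₀ : ∀ a b → Good π₀ (π (col a)) (col b)
        -- The tail of the occurrence lies to the right of every lower column, and its labels in `S`
        -- lie above every lower row. So every cell of the rectangle spanned by the lower part is
        -- good for `π`, hence for `π₀`.
        good-π₀ a b = from (agree⇒good⇔ agree _ _) (good {embedding = ι} (isTailOccurrence
          (λ _ _ _ → ι-inc)
          (λ x i₁≤x → ι-inc (ℕ.<-≤-trans (inject-< b) i₁≤x))
          (λ x s → ι-ord _ _ (below-tail (inject-< a) s))
          (λ x y s t r → ι-ord _ _ (from (tail-order s t) r))))
        goodColumn : ∀ b → GoodColumn π₀ (col b)
        goodColumn b = decidable-stable (goodColumn? (col b)) λ ¬g →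
          ¬g (subst (λ v → Good π₀ v (col b)) (to (agree _ _ ¬g) refl) (good-π₀ b b))
        c : Fin (toℕ i₁) → Fin size
        c b = C.index (col b) (goodColumn b)
        elem-c : ∀ b → C.elem (c b) ≡ col b
        elem-c b = C.elem-index _ _
        row : Fin (toℕ i₁) → Fin size
        row b = proj₁ (T.columns (c b))
        elem-row : ∀ b → V.elem (row b) ≡ π (col b)
        elem-row b = sym (π-column trans-T rep (goodColumn b))
        row-injective : Injective _≡_ _≡_ row
        row-injective {x} {y} eq = inject-injective i₁ (increasing⇒injective ι-inc
          (proj₁ (represents⇒permutation trans-T rep)
            (trans (sym (elem-row x)) (trans (cong V.elem eq) (elem-row y)))))
        build : ∃[ r ] ∃[ σ ] (Increasing r × (∀ x → ∃[ b ] row b ≡ r x) × (∀ b → r (σ b) ≡ row b)) →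
                BoardContains (below p i₁) board T
        build (r , σ , r-inc , r-image , r-σ) = r , c , σ , r-inc
          , (λ {x} {y} x<y → increasing-cancel-< C.increasing
              (subst₂ _<_ (sym (elem-c x)) (sym (elem-c y)) (ι-inc (inject-increasing i₁ x<y))))
          , cells
          , (λ b → subst (λ i → T i (c b) ≡ 1F) (sym (r-σ b)) (proj₁ (proj₂ (T.columns (c b)))))
          , (λ x y x<y → increasing-cancel-< r-inc (subst₂ _<_ (sym (r-σ x)) (sym (r-σ y))
              (increasing-cancel-< V.increasing (subst₂ _<_ (sym (elem-row x)) (sym (elem-row y))
                (ι-ord _ _ (<-inject⁺ x<y))))))
          where
          cells : ∀ a b → InBoard board (r a) (c b)
          cells a b = good⇒<rowLength (subst₂ (Good π₀)
            (trans (sym (elem-row b′)) (cong V.elem (proj₂ (r-image a)))) (sym (elem-c b)) (good-π₀ b′ b))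
            where b′ = proj₁ (r-image a)

      boardContains⇒contains : BoardContains (below p i₁) board T → Contains p π
      boardContains⇒contains (r , c , σ , r-inc , c-inc , cells , ones , ord) =
        ι , ι-inc , ι-ord
        where
        top = proj₁ (greatest 0<i₁)
        ≤top = proj₂ (greatest 0<i₁)
        -- A tail witness for the top right cell of the rectangle lies to the right of all its
        -- columns, with the labels in `S` above all its rows, so it extends the lower part to an
        -- occurrence of `p`.
        corner : Good π (V.elem (r top)) (C.elem (c top))
        corner = to (agree⇒good⇔ agree _ _) (<rowLength⇒good (cells top top))
        τ = Good.embedding corner
        open IsTailOccurrence (Good.tailOccurrence corner)
          renaming (increasing to τ-inc; right to τ-right; above to τ-above; ordered to τ-ord)
        low : Fin (toℕ i₁) → Fin n
        low b = C.elem (c b)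
        π-low : ∀ b → π (low b) ≡ V.elem (r (σ b))
        π-low b = to (proj₁ rep _ _) (ones b)
        ι : Fin k → Fin n
        ι x with x <? i₁
        ... | yes x<i₁ = low (fromℕ< x<i₁)
        ... | no _     = τ x
        ι-low : ∀ {x} (x<i₁ : x < i₁) → ι x ≡ low (fromℕ< x<i₁)
        ι-low {x} x<i₁ with x <? i₁
        ... | yes _    = refl
        ... | no x≮i₁ = contradiction x<i₁ x≮i₁
        ι-tail : ∀ {x} → i₁ ≤ x → ι x ≡ τ x
        ι-tail {x} i₁≤x with x <? i₁
        ... | yes x<i₁ = contradiction i₁≤x (ℕ.<⇒≱ x<i₁)
        ... | no _     = refl
        ι-inc : Increasing ι
        ι-inc {x} {y} x<y with x <? i₁ | y <? i₁
        ... | yes x<i₁ | yes y<i₁ = C.increasing (c-inc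
          (subst₂ ℕ._<_ (sym (toℕ-fromℕ< x<i₁)) (sym (toℕ-fromℕ< y<i₁)) x<y))
        ... | yes x<i₁ | no y≮i₁ = ℕ.≤-<-trans
          (increasing-mono-≤ C.increasing (increasing-mono-≤ c-inc (≤top _))) (τ-right y (ℕ.≮⇒≥ y≮i₁))
        ... | no x≮i₁ | yes y<i₁ = contradiction (ℕ.<-trans x<y y<i₁) x≮i₁
        ... | no x≮i₁ | no y≮i₁ = τ-inc x y (ℕ.≮⇒≥ x≮i₁) x<y
        π-ι-low : ∀ {x} (x<i₁ : x < i₁) → π (ι x) ≡ V.elem (r (σ (fromℕ< x<i₁)))
        π-ι-low x<i₁ = trans (cong π (ι-low x<i₁)) (π-low _)
        π-ι-tail : ∀ {x} → S x → π (ι x) ≡ π (τ x)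
        π-ι-tail s = cong π (ι-tail (S⇒≥ s))
        ι-ord : ∀ x y → x <[ p ] y → π (ι x) < π (ι y)
        ι-ord x y x<y with cases x<y
        ... | inj₁ (x<i₁ , y<i₁) = subst₂ _<_ (sym (π-ι-low x<i₁)) (sym (π-ι-low y<i₁))
          (V.increasing (r-inc (ord _ _ (<-inject⁻
            (subst₂ (strictOrder p) (sym (inject-fromℕ< x<i₁)) (sym (inject-fromℕ< y<i₁)) x<y)))))
        ... | inj₂ (inj₁ (x<i₁ , sy)) = subst₂ _<_ (sym (π-ι-low x<i₁)) (sym (π-ι-tail sy))
          (ℕ.≤-<-trans (increasing-mono-≤ V.increasing (increasing-mono-≤ r-inc (≤top _))) (τ-above y sy))
        ... | inj₂ (inj₂ (sx , sy)) = subst₂ _<_ (sym (π-ι-tail sx)) (sym (π-ι-tail sy))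
          (τ-ord x y sx sy (to (tail-order sx sy) x<y))

    -- The pattern enters only through avoidance, while the board is built from `π₀`, `S` and `R`.
    -- Hence the same board serves both patterns.
    count-class : ∀ {p : POP k} → SplitsAt i₁ S R p → 0 ℕ.< toℕ i₁ →
      count (λ π → (isPermutation? π ×-dec avoids? p π) ×-dec (key π ℕ.≟ key π₀)) (words n)
      ≡ #transversals board (below p i₁)
    count-class {p} splits 0<i₁ = begin
      count permutation? (words n)              ≡⟨ cong (count permutation?) (map-tabulate id finToFun) ⟩
      count permutation? (tabulate finToFun)    ≡⟨ matching⇒≡ (λ x y → Represents (finToFun x) (decode₂ y))
                                                     (enumerate permutation? finToFun) (enumerate transversal? decode₂)
                                                     permutation⇒transversal transversal⇒permutation
                                                     unique (λ _ _ rep rep′ → decode₂-injective (represented-unique rep rep′)) ⟩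
      count transversal? (tabulate decode₂)     ≡⟨ cong (count transversal?) (map-tabulate id decode₂) ⟨
      count transversal? (fillings size)        ∎
      where
      open ≡-Reasoning
      permutation? = λ π → (isPermutation? π ×-dec avoids? p π) ×-dec (key π ℕ.≟ key π₀)
      transversal? = λ T → isTransversal? board T ×-dec boardAvoids? (below p i₁) board T
      permutation⇒transversal : ∀ x → _ → _
      permutation⇒transversal x ((perm , avoids) , key≡) with encodeFilling (key≡⇒agree (sym key≡))
      ... | y , rep = y , (trans-T , avoids ∘ boardContains⇒contains splits 0<i₁ trans-T rep) , rep
        where trans-T = represents⇒transversal perm (key≡⇒agree (sym key≡)) rep
      transversal⇒permutation : ∀ y → _ → _
      transversal⇒permutation y (trans-T , avoids) with encodeWord trans-T
      ... | x , rep = x ,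
        ((represents⇒permutation trans-T rep , avoids ∘ contains⇒boardContains splits 0<i₁ trans-T rep)
        , sym (agree⇒key≡ (represents⇒agree trans-T rep))) , rep
      unique : ∀ {x x′ y} → _ → _ → Represents (finToFun x) (decode₂ y) → Represents (finToFun x′) (decode₂ y) → x ≡ x′
      unique ((perm , _) , key≡) _ rep rep′ = finToFun-injective
        (represents-unique (represents⇒transversal perm (key≡⇒agree (sym key≡)) rep) rep rep′)

-- Shape-Wilf equivalence speaks of nonempty boards, but a class without good entries has the empty
-- board. There a pattern with at least one label cannot occur.
∼ₛ⇒#transversals≡ : ∀ {m} {p q : POP m} → 0 ℕ.< m → p ∼ₛ q →
                    ∀ {n} (Λ : FerrersBoard n) → #transversals Λ p ≡ #transversals Λ q
∼ₛ⇒#transversals≡ {suc m} {p} {q} _ p∼ₛq {zero} Λ = count-cong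
  (λ T → isTransversal? Λ T ×-dec boardAvoids? p Λ T) (λ T → isTransversal? Λ T ×-dec boardAvoids? q Λ T)
  (λ T → mk⇔ (λ (t , _) → t , no-occurrence q T) (λ (t , _) → t , no-occurrence p T)) (fillings 0)
  where
  no-occurrence : ∀ (o : POP (suc m)) T → BoardAvoids o Λ T
  no-occurrence _ _ (r , _) = ¬Fin0 (r 0F)
∼ₛ⇒#transversals≡ _ p∼ₛq {suc n} Λ = p∼ₛq (suc n) z<s Λ

isolated? : ∀ {k} (p : POP k) → Decidable (POP.Isolated p)
isolated? p i = all? λ j → ¬? (j ≟ i) →-dec ¬? ((i ≤ₚ? j) ⊎-dec (j ≤ₚ? i))
  where open POP p

<⇒nonisolated : ∀ {k} (p : POP k) {x y} → x <[ p ] y → ¬ POP.Isolated p x × ¬ POP.Isolated p y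
<⇒nonisolated p (x≤y , x≢y) = (λ iso → iso _ (x≢y ∘ sym) (inj₁ x≤y)) , (λ iso → iso _ x≢y (inj₂ x≤y))

-- Summation over the classes.

module _ {k} (i₁ : Fin k) {S : Pred (Fin k) 0ℓ} (S? : Decidable S) (S⇒≥ : ∀ {x} → S x → i₁ ≤ x)
         {R : Rel (Fin k) 0ℓ} (R? : Binary.Decidable R) {p q : POP k}
         (p-splits : SplitsAt i₁ S R p) (q-splits : SplitsAt i₁ S R q) where

  module _ (0<i₁ : 0 ℕ.< toℕ i₁) (shape : below p i₁ ∼ₛ below q i₁) {n : ℕ} where

    open Tail i₁ S? S⇒≥ R? {n}

    private
      avoiding? : (r : POP k) → Decidable (λ (π : Fin n → Fin n) → IsPermutation π × Avoids r π)
      avoiding? r π = isPermutation? π ×-dec avoids? r π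

      countKey : POP k → ℕ → ℕ
      countKey r b = count (λ π → avoiding? r π ×-dec (key π ℕ.≟ b)) (words n)

    count-class-≡ : ∀ {π₀} → IsPermutation π₀ → countKey p (key π₀) ≡ countKey q (key π₀)
    count-class-≡ {π₀} perm₀ = go (goodEnumerations perm₀)
      where
      go : ∃[ size ] (Enumeration (GoodColumn π₀) size × Enumeration (GoodRow π₀) size) →
           countKey p (key π₀) ≡ countKey q (key π₀)
      go (_ , columns , rows) = trans (count-class p-splits 0<i₁)
        (trans (∼ₛ⇒#transversals≡ {p = below p i₁} {below q i₁} 0<i₁ shape board) (sym (count-class q-splits 0<i₁)))
        where open Class perm₀ columns rows

    #avoiding-≡ : #avoiding n p ≡ #avoiding n q
    #avoiding-≡ = count-≡-by-fibres (avoiding? p) (avoiding? q) key (words n)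
      (λ b → fibre b (Any.any? (λ π → isPermutation? π ×-dec (key π ℕ.≟ b)) (words n)))
      _ (λ π → toℕ<n _)
      where
      -- The representative of a class may be any permutation with key `b`, avoiding or not, so one
      -- choice serves both counts.
      fibre : ∀ b → Dec (Any (λ π → IsPermutation π × key π ≡ b) (words n)) → countKey p b ≡ countKey q b
      fibre b (no ¬any) = trans (none p) (sym (none q))
        where
        none : ∀ r → countKey r b ≡ 0
        none r = count-none _ (λ ((perm , _) , key≡b) → perm , key≡b) ¬any
      fibre b (yes any) = subst (λ b → countKey p b ≡ countKey q b) (proj₂ (proj₂ (Any.satisfied any)))
        (count-class-≡ (proj₁ (proj₂ (Any.satisfied any))))

-- The case without lower labels, and the conclusion.

splitsAtBottom⇒< : ∀ {k} {i₁ : Fin k} {S R} {p q : POP k} → toℕ i₁ ≡ 0 → SplitsAt i₁ S R p → SplitsAt i₁ S R q →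
                   ∀ {x y} → x <[ p ] y → x <[ q ] y
splitsAtBottom⇒< {i₁ = i₁} {p = p} i₁≡0 p-splits q-splits x<y with SplitsAt.cases p-splits x<y
... | inj₁ (x<i₁ , _)        = contradiction (subst (_ ℕ.<_) i₁≡0 x<i₁) ℕ.n≮0
... | inj₂ (inj₁ (x<i₁ , _)) = contradiction (subst (_ ℕ.<_) i₁≡0 x<i₁) ℕ.n≮0
... | inj₂ (inj₂ (sx , sy))  =
  from (SplitsAt.tail-order q-splits sx sy) (to (SplitsAt.tail-order p-splits sx sy) x<y)

<⇔⇒∼ : ∀ {k} {p q : POP k} → (∀ {x y} → x <[ p ] y → x <[ q ] y) → (∀ {x y} → x <[ q ] y → x <[ p ] y) → p ∼ q
<⇔⇒∼ {p = p} {q} p⇒q q⇒p n _ = count-cong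
  (λ π → isPermutation? π ×-dec avoids? p π) (λ π → isPermutation? π ×-dec avoids? q π)
  (λ π → mk⇔
    (λ (perm , avoids) → perm , λ (ι , inc , ord) → avoids (ι , inc , λ x y x<y → ord x y (p⇒q x<y)))
    (λ (perm , avoids) → perm , λ (ι , inc , ord) → avoids (ι , inc , λ x y x<y → ord x y (q⇒p x<y))))
  (words n)

Upper : ∀ {k} → POP k → Fin k → Pred (Fin k) 0ℓ
Upper p i x = (i ≤ x) × (¬ POP.Isolated p x)

-- Labels in a strict relation are not isolated, and a label from `i₁` on cannot be less than one
-- below `i₁`, by antisymmetry with `low`. `S` and `R` are taken from `p` even when the pattern is
-- `p′`, so that both patterns share them.
splitsAt : ∀ {k} (p p′ : POP k) (i₁ : Fin k) →
           (∀ {v} → POP.Isolated p v → POP.Isolated p′ v) →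
           (∀ x y → i₁ ≤ x → ¬ POP.Isolated p x → y < i₁ → y <[ p′ ] x) →
           SameInducedOn (Upper p i₁) p′ p → SplitsAt i₁ (Upper p i₁) (strictOrder p) p′
splitsAt p p′ i₁ iso low same = record
  { below-tail = λ x<i₁ (i₁≤y , y-free) → low _ _ i₁≤y y-free x<i₁
  ; tail-order = λ sx sy → mk⇔
      (λ (x≤y , x≢y) → to (same _ _ sx sy) x≤y , x≢y)
      (λ (x≤y , x≢y) → from (same _ _ sx sy) x≤y , x≢y)
  ; cases = cases
  }
  where
  cases : ∀ {x y} → x <[ p′ ] y → (x < i₁ × y < i₁) ⊎ (x < i₁ × Upper p i₁ y) ⊎ (Upper p i₁ x × Upper p i₁ y)
  cases {x} {y} x<y@(x≤y , x≢y) with <⇒nonisolated p′ x<y | x <? i₁ | y <? i₁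
  ... | _         | yes x<i₁ | yes y<i₁ = inj₁ (x<i₁ , y<i₁)
  ... | _ , y-free | yes x<i₁ | no y≮i₁ = inj₂ (inj₁ (x<i₁ , ℕ.≮⇒≥ y≮i₁ , y-free ∘ iso))
  ... | x-free , y-free | no x≮i₁ | no y≮i₁ =
    inj₂ (inj₂ ((ℕ.≮⇒≥ x≮i₁ , x-free ∘ iso) , (ℕ.≮⇒≥ y≮i₁ , y-free ∘ iso)))
  ... | x-free , _ | no x≮i₁ | yes y<i₁ = contradiction
    (POP.antisym p′ x≤y (proj₁ (low x y (ℕ.≮⇒≥ x≮i₁) (x-free ∘ iso) y<i₁))) x≢y

theorem1p2 : ∀ {k : ℕ} (p p′ : POP k) →
    (∀ v → POP.Isolated p v ⇔ POP.Isolated p′ v) →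
    (i₁ : Fin k) → POP.Isolated p i₁ → (∀ v → POP.Isolated p v → i₁ ≤ v) →
    (∀ x y → i₁ ≤ x → ¬ POP.Isolated p x → y < i₁ → (y <[ p ] x) × (y <[ p′ ] x)) →
    below p i₁ ∼ₛ below p′ i₁ →
    SameInducedOn (λ x → (i₁ ≤ x) × (¬ POP.Isolated p x)) p p′ →
    p ∼ p′
theorem1p2 p p′ iso i₁ _ _ low shape same = conclude (toℕ i₁ ℕ.≟ 0)
  where
  p-splits : SplitsAt i₁ (Upper p i₁) (strictOrder p) p
  p-splits = splitsAt p p i₁ id (λ x y i₁≤x x-free y<i₁ → proj₁ (low x y i₁≤x x-free y<i₁))
    (λ _ _ _ _ → mk⇔ id id)
  p′-splits : SplitsAt i₁ (Upper p i₁) (strictOrder p) p′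
  p′-splits = splitsAt p p′ i₁ (to (iso _)) (λ x y i₁≤x x-free y<i₁ → proj₂ (low x y i₁≤x x-free y<i₁))
    (λ x y sx sy → mk⇔ (from (same x y sx sy)) (to (same x y sx sy)))
  conclude : Dec (toℕ i₁ ≡ 0) → p ∼ p′
  -- Without lower labels the rectangle has no top right cell to attach a tail to, so the strict
  -- orders are compared directly.
  conclude (yes i₁≡0) = <⇔⇒∼ {p = p} {p′}
    (splitsAtBottom⇒< {p = p} {p′} i₁≡0 p-splits p′-splits) (splitsAtBottom⇒< {p = p′} {p} i₁≡0 p′-splits p-splits)
  conclude (no i₁≢0) n _ = #avoiding-≡ i₁ (λ x → (i₁ ≤? x) ×-dec ¬? (isolated? p x)) proj₁ (POP._<ₚ?_ p) {p} {p′}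
    p-splits p′-splits (ℕ.n≢0⇒n>0 i₁≢0) shape {n}
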